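{- Let $t\ge 1$, let $A_0$ be the incidence matrix of a doubly regular tournament of order $4t-1$, and let $A_1=A_0+I$, where $I$ is the identity matrix. Then, for $i\in\{0,1\}$, the array $B_i$ with entries in $\{0,1\}$ defined by $$B_i(x,y,z)=A_i(x,y)+A_i(y,z)+A_i(z,x)\ \bmod 2,\qquad x,y,z\in\{1,\dots,4t-1\},$$ is a $\mathcal{C}^3_3(4t-1,K_i,\Lambda_i)$-cube, where $$K_0=(2t-1)(4t+3),\qquad \Lambda_0=(2t-1)(2t+3),$$ $$K_1=2(4t^2-5t+2),\qquad \Lambda_1=4(t-1)^2.$$
   Context: An incidence matrix of a symmetric $(v,k,\lambda)$ design is a $v\times v$ matrix over $\{0,1\}$ with exactly $k$ ones in every row and column, such that the scalar product of any two distinct rows, and of any two distinct columns, is $\lambda$. A doubly regular tournament of order $4t-1$ is a symmetric $(4t-1,2t-1,t-1)$ design whose incidence matrix $A$ satisfies $A+A^\top=J-I$, where $J$ is the all-ones matrix. A $v\times v\times v$ array is a function on $\{1,\dots,v\}^3$. A layer is obtained by fixing one of the three coordinates; two layers are parallel if they fix the same coordinate, to different values; their scalar product is the sum over all positions of the product of corresponding entries. A $\mathcal{C}^3_3(v,K,\Lambda)$-cube is a $v\times v\times v$ array over $\{0,1\}$ such that every layer (in each of the three directions) contains exactly $K$ ones and every two parallel layers have scalar product $\Lambda$. -}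

module Defs where

open import Data.Bool.Base using (if_then_else_)
open import Data.Fin.Base using (Fin)
open import Data.Fin.Properties using (_≟_)
open import Data.Nat.Base using (ℕ; _+_; _*_; _∸_; _≡ᵇ_)
open import Data.Nat.DivMod using (_%_)
open import Data.Nat.Properties using (+-*-semiring)
open import Data.Sum.Base using (_⊎_)
open import Data.Vec.Functional using (Vector; transpose)
open import Relation.Binary.PropositionalEquality.Core using (_≡_; _≢_)
open import Relation.Nullary.Decidable.Core using (does)
open import Algebra.Properties.Semiring.Sum +-*-semiring using (sum-syntax)

Matrix : ℕ → Set
Matrix v = Vector (Vector ℕ v) v

Array₃ : ℕ → Set
Array₃ v = Fin v → Fin v → Fin v → ℕ

Binary : ℕ → Set
Binary a = a ≡ 0 ⊎ a ≡ 1

𝐈 : ∀ {v} → Matrix v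
𝐈 x y = if does (x ≟ y) then 1 else 0

𝐉 : ∀ {v} → Matrix v
𝐉 x y = 1

infixl 6 _⊕_ _⊖_

_⊕_ : ∀ {v} → Matrix v → Matrix v → Matrix v
(A ⊕ B) x y = A x y + B x y

-- Entrywise truncated subtraction; it is only applied to 𝐉 ⊖ 𝐈, where no
-- truncation occurs.
_⊖_ : ∀ {v} → Matrix v → Matrix v → Matrix v
(A ⊖ B) x y = A x y ∸ B x y

-- Number of positions holding the entry 1.
ones : ∀ {n} → Vector ℕ n → ℕ
ones {n} a = ∑[ i < n ] (if a i ≡ᵇ 1 then 1 else 0)

ones₂ : ∀ {v} → Matrix v → ℕ
ones₂ {v} M = ∑[ i < v ] ones (M i)

infix 7 _·_ _··_

_·_ : ∀ {n} → Vector ℕ n → Vector ℕ n → ℕ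
_·_ {n} a b = ∑[ i < n ] (a i * b i)

_··_ : ∀ {v} → Matrix v → Matrix v → ℕ
_··_ {v} M N = ∑[ i < v ] (M i · N i)

-- The rows of A are the vectors A x; its columns are the vectors transpose A y.
record IsSymmetricDesign (v k l : ℕ) (A : Matrix v) : Set where
  field
    binary      : ∀ x y → Binary (A x y)
    row-ones    : ∀ x → ones (A x) ≡ k
    column-ones : ∀ y → ones (transpose A y) ≡ k
    row-prod    : ∀ x x′ → x ≢ x′ → A x · A x′ ≡ l
    column-prod : ∀ y y′ → y ≢ y′ → transpose A y · transpose A y′ ≡ l

-- The order is 4t − 1; the subtractions are exact for t ≥ 1.
record IsDoublyRegularTournament (t : ℕ) (A : Matrix (4 * t ∸ 1)) : Set where
  field
    design     : IsSymmetricDesign (4 * t ∸ 1) (2 * t ∸ 1) (t ∸ 1) A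
    tournament : ∀ x y → (A ⊕ transpose A) x y ≡ (𝐉 ⊖ 𝐈) x y

data Axis : Set where
  axis₁ axis₂ axis₃ : Axis

-- The layer of B on which the given coordinate has the value c.
layer : ∀ {v} → Array₃ v → Axis → Fin v → Matrix v
layer B axis₁ c y z = B c y z
layer B axis₂ c x z = B x c z
layer B axis₃ c x y = B x y c

record IsCube (v K L : ℕ) (B : Array₃ v) : Set where
  field
    binary     : ∀ x y z → Binary (B x y z)
    layer-ones : ∀ d c → ones₂ (layer B d c) ≡ K
    layer-prod : ∀ d c c′ → c ≢ c′ → layer B d c ·· layer B d c′ ≡ L

cyclicArray : ∀ {v} → Matrix v → Array₃ v
cyclicArray A x y z = (A x y + A y z + A z x) % 2

-- The cube parameters.  All subtractions are exact for t ≥ 1; in K₁ the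
-- summand 2 of 4t² − 5t + 2 is added first, because 4t² < 5t when t = 1.
K₀ Λ₀ K₁ Λ₁ : ℕ → ℕ
K₀ t = (2 * t ∸ 1) * (4 * t + 3)
Λ₀ t = (2 * t ∸ 1) * (2 * t + 3)
K₁ t = 2 * ((4 * (t * t) + 2) ∸ 5 * t)
Λ₁ t = 4 * ((t ∸ 1) * (t ∸ 1))

{-# OPTIONS --safe #-}

-- Replace 0/1 entries by the signs (−1)ᵃ = 1 − 2a.  The tournament A₀ becomes a
-- ±1 matrix M with M + Mᵀ = 2εI, all line sums ε, and M Mᵀ = Mᵀ M = (v + 1)I − J,
-- where ε = 1; and A₁ = J − A₀ᵀ becomes −Mᵀ, which satisfies the same with ε = −1.
-- The array becomes M(x,y) M(y,z) M(z,x).  Its layer at c sums to (M³)(c,c), which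
-- Mᵀ = 2εI − M evaluates to ε(4 − 3v).  In the product of the layers at c ≠ c′ the
-- factors M(y,z)² disappear, leaving (M Mᵀ)(c,c′) (Mᵀ M)(c,c′) = (−1)(−1) = 1.
-- Since the array is invariant under cyclic rotation of (x,y,z), one direction of
-- layers suffices.
module Submission where

open import Defs
open import Data.Nat.Base using (ℕ; _≤_; _*_; _∸_)
open import Data.Product.Base using (_×_; _,_)

open import Data.Bool.Base using (true; false; if_then_else_)
open import Data.Fin.Base as Fin using (Fin)
import Data.Fin.Properties as Fin
open import Data.Integer.Base as ℤ using (ℤ; +_; 1ℤ; -1ℤ; -_)
import Data.Integer.Properties as ℤ
import Data.Integer.Tactic.RingSolver as ℤ-Solver
import Data.Nat.Base as ℕ
open import Data.Nat.DivMod using (_%_; m%n<n)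
import Data.Nat.Properties as ℕ
import Data.Nat.Tactic.RingSolver as ℕ-Solver
open import Data.Sum.Base using (inj₁; inj₂)
open import Data.Vec.Functional using (Vector; transpose)
open import Relation.Binary.PropositionalEquality
open import Relation.Nullary using (yes; no; does)
open import Relation.Nullary.Decidable using (dec-true)
open import Algebra.Properties.Semiring.Sum ℤ.+-*-semiring
  using (sum; sum-syntax; sum-cong-≗; ∑-distrib-+; *-distribˡ-sum; *-distribʳ-sum)
import Algebra.Properties.AbelianGroup ℤ.+-0-abelianGroup as ℤ+
import Algebra.Properties.Semiring.Sum ℕ.+-*-semiring as ℕΣ

open ≡-Reasoning

private variable
  n v : ℕ

-- Integer sums and casts from naturals to integers.

∑-const : ∀ n c → ∑[ i < n ] c ≡ + n ℤ.* c
∑-const ℕ.zero    c = sym (ℤ.*-zeroˡ c)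
∑-const (ℕ.suc n) c = trans (cong (ℤ._+_ c) (∑-const n c)) (sym (ℤ.suc-* (+ n) c))

-- The one splitting rule for sums below. Summands are first padded with factors such as `1ℤ` to
-- bring them to the shape a f + b g.
∑-linear : ∀ a b (f g : Vector ℤ n) →
  ∑[ i < n ] (a ℤ.* f i ℤ.+ b ℤ.* g i) ≡ a ℤ.* sum f ℤ.+ b ℤ.* sum g
∑-linear a b f g = trans (∑-distrib-+ (λ i → a ℤ.* f i) (λ i → b ℤ.* g i))
  (sym (cong₂ ℤ._+_ (*-distribˡ-sum a f) (*-distribˡ-sum b g)))

pos-∑ : (f : Vector ℕ n) → + ℕΣ.sum f ≡ ∑[ i < n ] (+ f i)
pos-∑ {ℕ.zero}  f = refl
pos-∑ {ℕ.suc n} f = trans (ℤ.pos-+ (f Fin.zero) _)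
  (cong (ℤ._+_ (+ f Fin.zero)) (pos-∑ (λ i → f (Fin.suc i))))

pos-∸ : ∀ {m n} → n ≤ m → + (m ∸ n) ≡ + m ℤ.- + n
pos-∸ {m} {n} n≤m = trans (sym (ℤ.⊖-≥ n≤m)) (sym (ℤ.m-n≡m⊖n m n))

δ : Fin v → Fin v → ℤ
δ x y = + 𝐈 x y

𝐈-refl : (x : Fin v) → 𝐈 x x ≡ 1
𝐈-refl x = cong (if_then 1 else 0) (dec-true (x Fin.≟ x) refl)

∑-δ : (c : Fin n) (f : Vector ℤ n) → ∑[ i < n ] (f i ℤ.* δ c i) ≡ f c
∑-δ {ℕ.suc n} Fin.zero f = begin
  f Fin.zero ℤ.* 1ℤ ℤ.+ ∑[ i < n ] (f (Fin.suc i) ℤ.* + 0)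
    ≡⟨ cong₂ ℤ._+_ (ℤ.*-identityʳ (f Fin.zero))
         (trans (sum-cong-≗ (λ i → ℤ.*-zeroʳ (f (Fin.suc i))))
           (trans (∑-const n (+ 0)) (ℤ.*-zeroʳ (+ n)))) ⟩
  f Fin.zero ℤ.+ + 0 ≡⟨ ℤ.+-identityʳ _ ⟩
  f Fin.zero ∎
∑-δ (Fin.suc c) f = trans
  (cong₂ ℤ._+_ (ℤ.*-zeroʳ (f Fin.zero)) (∑-δ c (λ i → f (Fin.suc i))))
  (ℤ.+-identityˡ _)

-- Signs of binary entries: counts of ones and scalar products as sign sums.

sign : ℕ → ℤ
sign a = 1ℤ ℤ.- + 2 ℤ.* + a

sign² : ∀ {a} → Binary a → sign a ℤ.* sign a ≡ 1ℤ
sign² (inj₁ refl) = refl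
sign² (inj₂ refl) = refl

-- Signs turn addition mod 2 into multiplication; each of the eight cases holds by computation.
sign-parity : ∀ {a b c} → Binary a → Binary b → Binary c →
  sign ((a ℕ.+ b ℕ.+ c) % 2) ≡ sign a ℤ.* sign b ℤ.* sign c
sign-parity (inj₁ refl) (inj₁ refl) (inj₁ refl) = refl
sign-parity (inj₁ refl) (inj₁ refl) (inj₂ refl) = refl
sign-parity (inj₁ refl) (inj₂ refl) (inj₁ refl) = refl
sign-parity (inj₁ refl) (inj₂ refl) (inj₂ refl) = refl
sign-parity (inj₂ refl) (inj₁ refl) (inj₁ refl) = refl
sign-parity (inj₂ refl) (inj₁ refl) (inj₂ refl) = refl
sign-parity (inj₂ refl) (inj₂ refl) (inj₁ refl) = refl
sign-parity (inj₂ refl) (inj₂ refl) (inj₂ refl) = refl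

<2⇒binary : ∀ {a} → a ℕ.< 2 → Binary a
<2⇒binary {0} _ = inj₁ refl
<2⇒binary {1} _ = inj₂ refl
<2⇒binary {ℕ.suc (ℕ.suc _)} (ℕ.s≤s (ℕ.s≤s ()))

ones≡∑ : {a : Vector ℕ n} → (∀ i → Binary (a i)) → ones a ≡ ℕΣ.sum a
ones≡∑ {a = a} bin = ℕΣ.sum-cong-≗ λ i → entry (bin i)
  where
  entry : ∀ {m} → Binary m → (if m ℕ.≡ᵇ 1 then 1 else 0) ≡ m
  entry (inj₁ refl) = refl
  entry (inj₂ refl) = refl

-- An entry 1 contributes -1 instead of 1, so each one lowers the sum by 2 from n.
∑-sign : {a : Vector ℕ n} → (∀ i → Binary (a i)) →
  ∑[ i < n ] sign (a i) ≡ + n ℤ.- + 2 ℤ.* + ones a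
∑-sign {n} {a} bin = begin
  ∑[ i < n ] sign (a i)
    ≡⟨ sum-cong-≗ (λ i → expand (+ a i)) ⟩
  ∑[ i < n ] (1ℤ ℤ.* 1ℤ ℤ.+ - + 2 ℤ.* + a i)
    ≡⟨ ∑-linear 1ℤ (- + 2) (λ _ → 1ℤ) (λ i → + a i) ⟩
  1ℤ ℤ.* ∑[ i < n ] 1ℤ ℤ.+ - + 2 ℤ.* ∑[ i < n ] (+ a i)
    ≡⟨ cong₂ (λ p q → 1ℤ ℤ.* p ℤ.+ - + 2 ℤ.* q) (∑-const n 1ℤ)
         (trans (sym (pos-∑ a)) (cong +_ (sym (ones≡∑ bin)))) ⟩
  1ℤ ℤ.* (+ n ℤ.* 1ℤ) ℤ.+ - + 2 ℤ.* + ones a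
    ≡⟨ collect (+ n) (+ ones a) ⟩
  + n ℤ.- + 2 ℤ.* + ones a ∎
  where
  expand : ∀ x → 1ℤ ℤ.- + 2 ℤ.* x ≡ 1ℤ ℤ.* 1ℤ ℤ.+ - + 2 ℤ.* x
  expand = ℤ-Solver.solve-∀
  collect : ∀ x y → 1ℤ ℤ.* (x ℤ.* 1ℤ) ℤ.+ - + 2 ℤ.* y ≡ x ℤ.- + 2 ℤ.* y
  collect = ℤ-Solver.solve-∀

∑-sign-* : {a b : Vector ℕ n} → (∀ i → Binary (a i)) → (∀ i → Binary (b i)) →
  ∑[ i < n ] (sign (a i) ℤ.* sign (b i))
    ≡ + n ℤ.- + 2 ℤ.* + ones a ℤ.- + 2 ℤ.* + ones b ℤ.+ + 4 ℤ.* + (a · b)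
∑-sign-* {n} {a} {b} bin-a bin-b = begin
  ∑[ i < n ] (sign (a i) ℤ.* sign (b i))
    -- The product (1 - 2a)(1 - 2b) is written as sign a + sign b - 1 + 4ab, so that `∑-sign`
    -- evaluates the first two terms.
    ≡⟨ sum-cong-≗ (λ i → trans (expand (+ a i) (+ b i))
         (cong (λ p → 1ℤ ℤ.* (1ℤ ℤ.* sign (a i) ℤ.+ 1ℤ ℤ.* sign (b i))
                  ℤ.+ 1ℤ ℤ.* (- 1ℤ ℤ.* 1ℤ ℤ.+ + 4 ℤ.* p)) (sym (ℤ.pos-* (a i) (b i))))) ⟩
  ∑[ i < n ] (1ℤ ℤ.* (1ℤ ℤ.* sign (a i) ℤ.+ 1ℤ ℤ.* sign (b i))
                  ℤ.+ 1ℤ ℤ.* (- 1ℤ ℤ.* 1ℤ ℤ.+ + 4 ℤ.* + (a i * b i)))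
    ≡⟨ ∑-linear 1ℤ 1ℤ (λ i → 1ℤ ℤ.* sign (a i) ℤ.+ 1ℤ ℤ.* sign (b i))
         (λ i → - 1ℤ ℤ.* 1ℤ ℤ.+ + 4 ℤ.* + (a i * b i)) ⟩
  _ ≡⟨ cong₂ (λ p q → 1ℤ ℤ.* p ℤ.+ 1ℤ ℤ.* q)
         (∑-linear 1ℤ 1ℤ (λ i → sign (a i)) (λ i → sign (b i)))
         (∑-linear (- 1ℤ) (+ 4) (λ _ → 1ℤ) (λ i → + (a i * b i))) ⟩
  _ ≡⟨ cong₂ (λ p q → 1ℤ ℤ.* p ℤ.+ 1ℤ ℤ.* q)
         (cong₂ (λ p q → 1ℤ ℤ.* p ℤ.+ 1ℤ ℤ.* q) (∑-sign bin-a) (∑-sign bin-b))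
         (cong₂ (λ p q → - 1ℤ ℤ.* p ℤ.+ + 4 ℤ.* q) (∑-const n 1ℤ)
           (sym (pos-∑ (λ i → a i * b i)))) ⟩
  _ ≡⟨ collect (+ n) (+ ones a) (+ ones b) (+ (a · b)) ⟩
  + n ℤ.- + 2 ℤ.* + ones a ℤ.- + 2 ℤ.* + ones b ℤ.+ + 4 ℤ.* + (a · b) ∎
  where
  expand : ∀ x y → (1ℤ ℤ.- + 2 ℤ.* x) ℤ.* (1ℤ ℤ.- + 2 ℤ.* y)
    ≡ 1ℤ ℤ.* (1ℤ ℤ.* (1ℤ ℤ.- + 2 ℤ.* x) ℤ.+ 1ℤ ℤ.* (1ℤ ℤ.- + 2 ℤ.* y))
      ℤ.+ 1ℤ ℤ.* (- 1ℤ ℤ.* 1ℤ ℤ.+ + 4 ℤ.* (x ℤ.* y))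
  expand = ℤ-Solver.solve-∀
  collect : ∀ w x y z →
    1ℤ ℤ.* (1ℤ ℤ.* (w ℤ.- + 2 ℤ.* x) ℤ.+ 1ℤ ℤ.* (w ℤ.- + 2 ℤ.* y))
      ℤ.+ 1ℤ ℤ.* (- 1ℤ ℤ.* (w ℤ.* 1ℤ) ℤ.+ + 4 ℤ.* z)
    ≡ w ℤ.- + 2 ℤ.* x ℤ.- + 2 ℤ.* y ℤ.+ + 4 ℤ.* z
  collect = ℤ-Solver.solve-∀

∑∑-sign : {N : Matrix v} → (∀ i j → Binary (N i j)) →
  ∑[ i < v ] ∑[ j < v ] sign (N i j) ≡ + v ℤ.* + v ℤ.- + 2 ℤ.* + ones₂ N
∑∑-sign {v} {N} bin = begin
  ∑[ i < v ] ∑[ j < v ] sign (N i j)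
    ≡⟨ sum-cong-≗ (λ i → trans (∑-sign (bin i)) (expand (+ v) (+ ones (N i)))) ⟩
  ∑[ i < v ] (1ℤ ℤ.* + v ℤ.+ - + 2 ℤ.* + ones (N i))
    ≡⟨ ∑-linear 1ℤ (- + 2) (λ _ → + v) (λ i → + ones (N i)) ⟩
  _ ≡⟨ cong₂ (λ p q → 1ℤ ℤ.* p ℤ.+ - + 2 ℤ.* q) (∑-const v (+ v))
         (sym (pos-∑ (λ i → ones (N i)))) ⟩
  1ℤ ℤ.* (+ v ℤ.* + v) ℤ.+ - + 2 ℤ.* + ones₂ N
    ≡⟨ expand (+ v ℤ.* + v) (+ ones₂ N) ⟨
  + v ℤ.* + v ℤ.- + 2 ℤ.* + ones₂ N ∎
  where
  expand : ∀ x y → x ℤ.- + 2 ℤ.* y ≡ 1ℤ ℤ.* x ℤ.+ - + 2 ℤ.* y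
  expand = ℤ-Solver.solve-∀

-- Once the numbers of ones in both matrices are known, this equation determines `N ·· P` from the
-- sum of sign products.
∑∑-sign-* : {N P : Matrix v} →
  (∀ i j → Binary (N i j)) → (∀ i j → Binary (P i j)) →
  ∑[ i < v ] ∑[ j < v ] (sign (N i j) ℤ.* sign (P i j))
    ≡ + v ℤ.* + v ℤ.- + 2 ℤ.* + ones₂ N ℤ.- + 2 ℤ.* + ones₂ P ℤ.+ + 4 ℤ.* + (N ·· P)
∑∑-sign-* {v} {N} {P} bin-N bin-P = begin
  ∑[ i < v ] ∑[ j < v ] (sign (N i j) ℤ.* sign (P i j))
    ≡⟨ sum-cong-≗ (λ i → trans (∑-sign-* (bin-N i) (bin-P i))
         (expand (+ v) (+ ones (N i)) (+ ones (P i)) (+ (N i · P i)))) ⟩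
  ∑[ i < v ] (1ℤ ℤ.* (1ℤ ℤ.* + v ℤ.+ - + 2 ℤ.* + ones (N i))
                ℤ.+ 1ℤ ℤ.* (- + 2 ℤ.* + ones (P i) ℤ.+ + 4 ℤ.* + (N i · P i)))
    ≡⟨ ∑-linear 1ℤ 1ℤ (λ i → 1ℤ ℤ.* + v ℤ.+ - + 2 ℤ.* + ones (N i))
         (λ i → - + 2 ℤ.* + ones (P i) ℤ.+ + 4 ℤ.* + (N i · P i)) ⟩
  _ ≡⟨ cong₂ (λ p q → 1ℤ ℤ.* p ℤ.+ 1ℤ ℤ.* q)
         (∑-linear 1ℤ (- + 2) (λ _ → + v) (λ i → + ones (N i)))
         (∑-linear (- + 2) (+ 4) (λ i → + ones (P i)) (λ i → + (N i · P i))) ⟩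
  _ ≡⟨ cong₂ (λ p q → 1ℤ ℤ.* p ℤ.+ 1ℤ ℤ.* q)
         (cong₂ (λ p q → 1ℤ ℤ.* p ℤ.+ - + 2 ℤ.* q) (∑-const v (+ v))
           (sym (pos-∑ (λ i → ones (N i)))))
         (cong₂ (λ p q → - + 2 ℤ.* p ℤ.+ + 4 ℤ.* q)
           (sym (pos-∑ (λ i → ones (P i)))) (sym (pos-∑ (λ i → N i · P i)))) ⟩
  _ ≡⟨ expand (+ v ℤ.* + v) (+ ones₂ N) (+ ones₂ P) (+ (N ·· P)) ⟨
  + v ℤ.* + v ℤ.- + 2 ℤ.* + ones₂ N ℤ.- + 2 ℤ.* + ones₂ P ℤ.+ + 4 ℤ.* + (N ·· P) ∎
  where
  expand : ∀ w x y z → w ℤ.- + 2 ℤ.* x ℤ.- + 2 ℤ.* y ℤ.+ + 4 ℤ.* z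
    ≡ 1ℤ ℤ.* (1ℤ ℤ.* w ℤ.+ - + 2 ℤ.* x) ℤ.+ 1ℤ ℤ.* (- + 2 ℤ.* y ℤ.+ + 4 ℤ.* z)
  expand = ℤ-Solver.solve-∀

-- Sign matrices of skew type and their triangle sums.

-- Up to sign, such an `M` is the core of a skew Hadamard matrix of order v + 1. The parameter `ε`
-- lets both arrays be treated at once.
record IsSkewCore (v : ℕ) (ε : ℤ) (M : Fin v → Fin v → ℤ) : Set where
  field
    ε²       : ε ℤ.* ε ≡ 1ℤ
    entry²   : ∀ x y → M x y ℤ.* M x y ≡ 1ℤ
    row-sum  : ∀ x → ∑[ y < v ] M x y ≡ ε
    col-sum  : ∀ y → ∑[ x < v ] M x y ≡ ε
    row-prod : ∀ x x′ → x ≢ x′ → ∑[ y < v ] (M x y ℤ.* M x′ y) ≡ -1ℤ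
    col-prod : ∀ y y′ → y ≢ y′ → ∑[ x < v ] (M x y ℤ.* M x y′) ≡ -1ℤ
    skew     : ∀ x y → M x y ℤ.+ M y x ≡ + 2 ℤ.* ε ℤ.* δ x y

module SkewCore {v ε M} (core : IsSkewCore v ε M) where
  open IsSkewCore core

  diagonal : ∀ x → M x x ≡ ε
  diagonal x = ℤ.*-cancelˡ-≡ (+ 2) (M x x) ε (begin
    + 2 ℤ.* M x x          ≡⟨ double (M x x) ⟩
    M x x ℤ.+ M x x        ≡⟨ skew x x ⟩
    + 2 ℤ.* ε ℤ.* δ x x    ≡⟨ cong (λ d → + 2 ℤ.* ε ℤ.* + d) (𝐈-refl x) ⟩
    + 2 ℤ.* ε ℤ.* 1ℤ       ≡⟨ ℤ.*-identityʳ _ ⟩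
    + 2 ℤ.* ε              ∎)
    where
    double : ∀ a → + 2 ℤ.* a ≡ a ℤ.+ a
    double = ℤ-Solver.solve-∀

  transposed : ∀ x y → M y x ≡ + 2 ℤ.* ε ℤ.* δ x y ℤ.- M x y
  transposed x y = trans (solve-for (M x y) (M y x)) (cong (ℤ._- M x y) (skew x y))
    where
    solve-for : ∀ a b → b ≡ (a ℤ.+ b) ℤ.- a
    solve-for = ℤ-Solver.solve-∀

  -- Entrywise form of M Mᵀ = (v + 1)I - J, joining `entry²` and `row-prod`. The order in `δ x′ x`
  -- makes `gram y c` produce `δ c y`, the same term that `transposed c y` produces.
  gram : ∀ x x′ → ∑[ y < v ] (M x y ℤ.* M x′ y) ≡ (+ v ℤ.+ 1ℤ) ℤ.* δ x′ x ℤ.- 1ℤ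
  gram x x′ with x′ Fin.≟ x
  ... | yes refl = trans (sum-cong-≗ (entry² x)) (trans (∑-const v 1ℤ) (collect (+ v)))
    where
    collect : ∀ w → w ℤ.* 1ℤ ≡ (w ℤ.+ 1ℤ) ℤ.* 1ℤ ℤ.- 1ℤ
    collect = ℤ-Solver.solve-∀
  ... | no x′≢x = trans (row-prod x x′ (≢-sym x′≢x)) (vanish (+ v))
    where
    vanish : ∀ w → -1ℤ ≡ (w ℤ.+ 1ℤ) ℤ.* + 0 ℤ.- 1ℤ
    vanish = ℤ-Solver.solve-∀

  triangle : Fin v → Fin v → Fin v → ℤ
  triangle x y z = M x y ℤ.* M y z ℤ.* M z x

  -- The sum is M(c,y) (M²)(y,c), where M² = M(2εI - Mᵀ) = 2εM - M Mᵀ. The delta is kept in the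
  -- result so that `∑-δ` can act in the sum over y.
  ∑-triangle : ∀ c y → ∑[ z < v ] triangle c y z
    ≡ (+ 4 ℤ.- (+ v ℤ.+ 1ℤ)) ℤ.* (M c y ℤ.* δ c y) ℤ.+ 1ℤ ℤ.* (M c y ℤ.- + 2 ℤ.* ε)
  ∑-triangle c y = begin
    ∑[ z < v ] (M c y ℤ.* M y z ℤ.* M z c)
      -- Replacing `M z c` by 2εδ(c,z) - M(c,z) leaves a delta sum and the scalar product of rows y
      -- and c.
      ≡⟨ sum-cong-≗ (λ z → trans (cong (M c y ℤ.* M y z ℤ.*_) (transposed c z))
           (split (M c y) (M y z) (M c z) ε (δ c z))) ⟩
    ∑[ z < v ] (M c y ℤ.* (+ 2 ℤ.* ε) ℤ.* (M y z ℤ.* δ c z)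
                  ℤ.+ - M c y ℤ.* (M y z ℤ.* M c z))
      ≡⟨ ∑-linear (M c y ℤ.* (+ 2 ℤ.* ε)) (- M c y)
           (λ z → M y z ℤ.* δ c z) (λ z → M y z ℤ.* M c z) ⟩
    _ ≡⟨ cong₂ (λ p q → M c y ℤ.* (+ 2 ℤ.* ε) ℤ.* p ℤ.+ - M c y ℤ.* q)
           (trans (∑-δ c (M y)) (transposed c y)) (gram y c) ⟩
    M c y ℤ.* (+ 2 ℤ.* ε) ℤ.* (+ 2 ℤ.* ε ℤ.* δ c y ℤ.- M c y)
      ℤ.+ - M c y ℤ.* ((+ v ℤ.+ 1ℤ) ℤ.* δ c y ℤ.- 1ℤ)
      ≡⟨ gather (M c y) ε (δ c y) (+ v ℤ.+ 1ℤ) ⟩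
    (+ 4 ℤ.* (ε ℤ.* ε) ℤ.- (+ v ℤ.+ 1ℤ)) ℤ.* (M c y ℤ.* δ c y)
      ℤ.+ 1ℤ ℤ.* (M c y ℤ.- + 2 ℤ.* ε ℤ.* (M c y ℤ.* M c y))
      ≡⟨ cong₂ (λ p q → (+ 4 ℤ.* p ℤ.- (+ v ℤ.+ 1ℤ)) ℤ.* (M c y ℤ.* δ c y)
                          ℤ.+ 1ℤ ℤ.* (M c y ℤ.- + 2 ℤ.* ε ℤ.* q))
           ε² (entry² c y) ⟩
    _ ≡⟨ cong (λ q → (+ 4 ℤ.- (+ v ℤ.+ 1ℤ)) ℤ.* (M c y ℤ.* δ c y)
                       ℤ.+ 1ℤ ℤ.* (M c y ℤ.- q)) (ℤ.*-identityʳ (+ 2 ℤ.* ε)) ⟩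
    (+ 4 ℤ.- (+ v ℤ.+ 1ℤ)) ℤ.* (M c y ℤ.* δ c y) ℤ.+ 1ℤ ℤ.* (M c y ℤ.- + 2 ℤ.* ε) ∎
    where
    split : ∀ a b m e d → a ℤ.* b ℤ.* (+ 2 ℤ.* e ℤ.* d ℤ.- m)
      ≡ a ℤ.* (+ 2 ℤ.* e) ℤ.* (b ℤ.* d) ℤ.+ - a ℤ.* (b ℤ.* m)
    split = ℤ-Solver.solve-∀
    gather : ∀ a e d w →
      a ℤ.* (+ 2 ℤ.* e) ℤ.* (+ 2 ℤ.* e ℤ.* d ℤ.- a) ℤ.+ - a ℤ.* (w ℤ.* d ℤ.- 1ℤ)
      ≡ (+ 4 ℤ.* (e ℤ.* e) ℤ.- w) ℤ.* (a ℤ.* d)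
          ℤ.+ 1ℤ ℤ.* (a ℤ.- + 2 ℤ.* e ℤ.* (a ℤ.* a))
    gather = ℤ-Solver.solve-∀

  -- The delta term picks out M(c,c) = ε and gives (3 - v)ε; the row sum gives ε, and the constant
  -- -2ε, taken v times, gives -2vε.
  ∑∑-triangle : ∀ c →
    ∑[ y < v ] ∑[ z < v ] triangle c y z ≡ ε ℤ.* (+ 4 ℤ.- + 3 ℤ.* + v)
  ∑∑-triangle c = begin
    ∑[ y < v ] ∑[ z < v ] triangle c y z
      ≡⟨ sum-cong-≗ (∑-triangle c) ⟩
    ∑[ y < v ] ((+ 4 ℤ.- (+ v ℤ.+ 1ℤ)) ℤ.* (M c y ℤ.* δ c y)
                  ℤ.+ 1ℤ ℤ.* (M c y ℤ.- + 2 ℤ.* ε))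
      ≡⟨ ∑-linear (+ 4 ℤ.- (+ v ℤ.+ 1ℤ)) 1ℤ (λ y → M c y ℤ.* δ c y)
           (λ y → M c y ℤ.- + 2 ℤ.* ε) ⟩
    _ ≡⟨ cong₂ (λ p q → (+ 4 ℤ.- (+ v ℤ.+ 1ℤ)) ℤ.* p ℤ.+ 1ℤ ℤ.* q)
           (trans (∑-δ c (M c)) (diagonal c))
           (trans (∑-distrib-+ (M c) (λ _ → - (+ 2 ℤ.* ε)))
             (cong₂ ℤ._+_ (row-sum c) (∑-const v (- (+ 2 ℤ.* ε))))) ⟩
    (+ 4 ℤ.- (+ v ℤ.+ 1ℤ)) ℤ.* ε ℤ.+ 1ℤ ℤ.* (ε ℤ.+ + v ℤ.* - (+ 2 ℤ.* ε))
      ≡⟨ collect (+ v) ε ⟩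
    ε ℤ.* (+ 4 ℤ.- + 3 ℤ.* + v) ∎
    where
    collect : ∀ w e → (+ 4 ℤ.- (w ℤ.+ 1ℤ)) ℤ.* e ℤ.+ 1ℤ ℤ.* (e ℤ.+ w ℤ.* - (+ 2 ℤ.* e))
      ≡ e ℤ.* (+ 4 ℤ.- + 3 ℤ.* w)
    collect = ℤ-Solver.solve-∀

  ∑∑-triangle-* : ∀ c c′ → c ≢ c′ →
    ∑[ y < v ] ∑[ z < v ] (triangle c y z ℤ.* triangle c′ y z) ≡ 1ℤ
  ∑∑-triangle-* c c′ c≢c′ = begin
    ∑[ y < v ] ∑[ z < v ] (triangle c y z ℤ.* triangle c′ y z)
      ≡⟨ sum-cong-≗ (λ y → sum-cong-≗ (λ z → separate y z)) ⟩
    ∑[ y < v ] ∑[ z < v ] (M c y ℤ.* M c′ y ℤ.* (M z c ℤ.* M z c′))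
      -- Each summand is now a function of y times a function of z, so the double sum splits into a
      -- row product times a column product.
      ≡⟨ sum-cong-≗ (λ y → trans
           (sym (*-distribˡ-sum (M c y ℤ.* M c′ y) (λ z → M z c ℤ.* M z c′)))
           (cong (M c y ℤ.* M c′ y ℤ.*_) (col-prod c c′ c≢c′))) ⟩
    ∑[ y < v ] (M c y ℤ.* M c′ y ℤ.* -1ℤ)
      ≡⟨ *-distribʳ-sum -1ℤ (λ y → M c y ℤ.* M c′ y) ⟨
    ∑[ y < v ] (M c y ℤ.* M c′ y) ℤ.* -1ℤ
      ≡⟨ cong (ℤ._* -1ℤ) (row-prod c c′ c≢c′) ⟩
    1ℤ ∎
    where
    regroup : ∀ a b p q m → a ℤ.* m ℤ.* p ℤ.* (b ℤ.* m ℤ.* q)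
      ≡ a ℤ.* b ℤ.* (p ℤ.* q) ℤ.* (m ℤ.* m)
    regroup = ℤ-Solver.solve-∀
    separate : ∀ y z → triangle c y z ℤ.* triangle c′ y z
      ≡ M c y ℤ.* M c′ y ℤ.* (M z c ℤ.* M z c′)
    separate y z = trans (regroup (M c y) (M c′ y) (M z c) (M z c′) (M y z))
      (trans (cong (M c y ℤ.* M c′ y ℤ.* (M z c ℤ.* M z c′) ℤ.*_) (entry² y z))
        (ℤ.*-identityʳ _))

∑-neg : (f : Vector ℤ n) → ∑[ i < n ] (- f i) ≡ - sum f
∑-neg f = trans (sum-cong-≗ (λ i → sym (ℤ.-1*i≡-i (f i))))
  (trans (sym (*-distribˡ-sum -1ℤ f)) (ℤ.-1*i≡-i (sum f)))

-- Rows and columns exchange roles; the minus sign cancels in products of two entries and flips `ε`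
-- in the linear conditions.
neg-transpose : ∀ {ε M} → IsSkewCore v ε M → IsSkewCore v (- ε) (λ x y → - M y x)
neg-transpose {ε = ε} {M} core = record
  { ε²       = trans (neg-* ε ε) ε²
  ; entry²   = λ x y → trans (neg-* (M y x) (M y x)) (entry² y x)
  ; row-sum  = λ x → trans (∑-neg (λ y → M y x)) (cong -_ (col-sum x))
  ; col-sum  = λ y → trans (∑-neg (M y)) (cong -_ (row-sum y))
  ; row-prod = λ x x′ x≢x′ →
      trans (sum-cong-≗ (λ y → neg-* (M y x) (M y x′))) (col-prod x x′ x≢x′)
  ; col-prod = λ y y′ y≢y′ →
      trans (sum-cong-≗ (λ x → neg-* (M y x) (M y′ x))) (row-prod y y′ y≢y′)
  ; skew     = λ x y → trans (neg-+ (M x y) (M y x))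
      (trans (cong -_ (skew x y)) (neg-out ε (δ x y)))
  }
  where
  open IsSkewCore core
  neg-* : ∀ a b → - a ℤ.* - b ≡ a ℤ.* b
  neg-* = ℤ-Solver.solve-∀
  neg-+ : ∀ a b → - b ℤ.+ - a ≡ - (a ℤ.+ b)
  neg-+ = ℤ-Solver.solve-∀
  neg-out : ∀ e d → - (+ 2 ℤ.* e ℤ.* d) ≡ + 2 ℤ.* - e ℤ.* d
  neg-out = ℤ-Solver.solve-∀

-- Layers of the cyclic array.

cyclicArray-rotate : (A : Matrix v) → ∀ x y z → cyclicArray A x y z ≡ cyclicArray A y z x
cyclicArray-rotate A x y z = cong (_% 2) (rotate (A x y) (A y z) (A z x))
  where
  rotate : ∀ a b c → a ℕ.+ b ℕ.+ c ≡ b ℕ.+ c ℕ.+ a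
  rotate = ℕ-Solver.solve-∀

cyclicArray-binary : (A : Matrix v) → ∀ x y z → Binary (cyclicArray A x y z)
cyclicArray-binary A x y z = <2⇒binary (m%n<n (A x y ℕ.+ A y z ℕ.+ A z x) 2)

ones₂-cong : {N P : Matrix v} → (∀ i j → N i j ≡ P i j) → ones₂ N ≡ ones₂ P
ones₂-cong N≗P = ℕΣ.sum-cong-≗ λ i → ℕΣ.sum-cong-≗ λ j →
  cong (λ a → if a ℕ.≡ᵇ 1 then 1 else 0) (N≗P i j)

ones₂-transpose : (N : Matrix v) → ones₂ (transpose N) ≡ ones₂ N
ones₂-transpose N = ℕΣ.∑-comm (λ j i → if N i j ℕ.≡ᵇ 1 then 1 else 0)

··-cong : {N N′ P P′ : Matrix v} → (∀ i j → N i j ≡ N′ i j) → (∀ i j → P i j ≡ P′ i j) →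
  N ·· P ≡ N′ ·· P′
··-cong N≗N′ P≗P′ = ℕΣ.sum-cong-≗ λ i → ℕΣ.sum-cong-≗ λ j →
  cong₂ _*_ (N≗N′ i j) (P≗P′ i j)

··-transpose : (N P : Matrix v) → transpose N ·· transpose P ≡ N ·· P
··-transpose N P = ℕΣ.∑-comm (λ j i → N i j * P i j)

-- The last two hypotheses are the equations ε(4 - 3v) = v² - 2K and 1 = v² - 4K + 4Λ, which
-- determine K and Λ. The integers `w`, `k`, `l` stand for the parameters so that both can be
-- supplied as polynomial identities in t, free of truncated subtraction.
cyclicArray-isCube : ∀ {v ε M K Λ w k l} {A : Matrix v} → IsSkewCore v ε M →
  (∀ x y → Binary (A x y)) → (∀ x y → sign (A x y) ≡ M x y) →
  + v ≡ w → + K ≡ k → + Λ ≡ l →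
  ε ℤ.* (+ 4 ℤ.- + 3 ℤ.* w) ≡ w ℤ.* w ℤ.- + 2 ℤ.* k →
  1ℤ ≡ w ℤ.* w ℤ.- + 2 ℤ.* k ℤ.- + 2 ℤ.* k ℤ.+ + 4 ℤ.* l →
  IsCube v K Λ (cyclicArray A)
cyclicArray-isCube {v} {ε} {M} {K} {Λ} {A = A} core A-binary sign-A refl refl refl K-eq Λ-eq =
  record
  { binary     = cyclicArray-binary A
  ; layer-ones = layer-ones
  ; layer-prod = layer-prod
  }
  where
  open SkewCore core

  B : Array₃ v
  B = cyclicArray A

  sign-B : ∀ x y z → sign (B x y z) ≡ triangle x y z
  sign-B x y z = trans (sign-parity (A-binary x y) (A-binary y z) (A-binary z x))
    (cong₂ ℤ._*_ (cong₂ ℤ._*_ (sign-A x y) (sign-A y z)) (sign-A z x))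

  ones₂-B : ∀ c → ones₂ (B c) ≡ K
  -- Both counts give the same value of v² - 2K; the term v², the minus sign and the factor 2 are
  -- cancelled in turn.
  ones₂-B c = ℤ.+-injective (ℤ.*-cancelˡ-≡ (+ 2) (+ ones₂ (B c)) (+ K)
    (ℤ.neg-injective (ℤ+.∙-cancelˡ (+ v ℤ.* + v) _ _ (begin
      + v ℤ.* + v ℤ.- + 2 ℤ.* + ones₂ (B c)
        ≡⟨ ∑∑-sign (cyclicArray-binary A c) ⟨
      ∑[ y < v ] ∑[ z < v ] sign (B c y z)
        ≡⟨ sum-cong-≗ (λ y → sum-cong-≗ (sign-B c y)) ⟩
      ∑[ y < v ] ∑[ z < v ] triangle c y z
        ≡⟨ ∑∑-triangle c ⟩
      ε ℤ.* (+ 4 ℤ.- + 3 ℤ.* + v)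
        ≡⟨ K-eq ⟩
      + v ℤ.* + v ℤ.- + 2 ℤ.* + K ∎))))

  prod-B : ∀ c c′ → c ≢ c′ → B c ·· B c′ ≡ Λ
  prod-B c c′ c≢c′ = ℤ.+-injective (ℤ.*-cancelˡ-≡ (+ 4) (+ (B c ·· B c′)) (+ Λ)
    (ℤ+.∙-cancelˡ (+ v ℤ.* + v ℤ.- + 2 ℤ.* + K ℤ.- + 2 ℤ.* + K) _ _ (begin
      + v ℤ.* + v ℤ.- + 2 ℤ.* + K ℤ.- + 2 ℤ.* + K ℤ.+ + 4 ℤ.* + (B c ·· B c′)
        -- Both layers are known to have `K` ones, so the scalar product is the only unknown left.
        ≡⟨ cong₂ (λ p q → + v ℤ.* + v ℤ.- + 2 ℤ.* + p ℤ.- + 2 ℤ.* + q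
                            ℤ.+ + 4 ℤ.* + (B c ·· B c′))
             (ones₂-B c) (ones₂-B c′) ⟨
      _ ≡⟨ ∑∑-sign-* (cyclicArray-binary A c) (cyclicArray-binary A c′) ⟨
      ∑[ y < v ] ∑[ z < v ] (sign (B c y z) ℤ.* sign (B c′ y z))
        ≡⟨ sum-cong-≗ (λ y → sum-cong-≗ (λ z →
             cong₂ ℤ._*_ (sign-B c y z) (sign-B c′ y z))) ⟩
      ∑[ y < v ] ∑[ z < v ] (triangle c y z ℤ.* triangle c′ y z)
        ≡⟨ ∑∑-triangle-* c c′ c≢c′ ⟩
      1ℤ
        ≡⟨ Λ-eq ⟩
      + v ℤ.* + v ℤ.- + 2 ℤ.* + K ℤ.- + 2 ℤ.* + K ℤ.+ + 4 ℤ.* + Λ ∎)))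

  -- Rotation sends (x,c,z) to (c,z,x), which exchanges the free coordinates; it sends (c,x,y) to
  -- (x,y,c), which keeps their order. Hence a transpose here and none in `layer₃`.
  layer₂ : ∀ c x z → layer B axis₂ c x z ≡ transpose (B c) x z
  layer₂ c x z = cyclicArray-rotate A x c z

  layer₃ : ∀ c x y → layer B axis₃ c x y ≡ B c x y
  layer₃ c x y = sym (cyclicArray-rotate A c x y)

  layer-ones : ∀ d c → ones₂ (layer B d c) ≡ K
  layer-ones axis₁ c = ones₂-B c
  layer-ones axis₂ c =
    trans (ones₂-cong (layer₂ c)) (trans (ones₂-transpose (B c)) (ones₂-B c))
  layer-ones axis₃ c = trans (ones₂-cong (layer₃ c)) (ones₂-B c)

  layer-prod : ∀ d c c′ → c ≢ c′ → layer B d c ·· layer B d c′ ≡ Λ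
  layer-prod axis₁ c c′ c≢c′ = prod-B c c′ c≢c′
  layer-prod axis₂ c c′ c≢c′ = trans (··-cong (layer₂ c) (layer₂ c′))
    (trans (··-transpose (B c) (B c′)) (prod-B c c′ c≢c′))
  layer-prod axis₃ c c′ c≢c′ =
    trans (··-cong (layer₃ c) (layer₃ c′)) (prod-B c c′ c≢c′)

-- The order and the cube parameters as integer polynomials in t.

pos-order : ∀ {t} → 1 ≤ t → + (4 * t ∸ 1) ≡ + 4 ℤ.* + t ℤ.- 1ℤ
pos-order {t} 1≤t = trans (pos-∸ (ℕ.≤-trans 1≤t (ℕ.m≤n*m t 4)))
  (cong (ℤ._- 1ℤ) (ℤ.pos-* 4 t))

pos-2t∸1 : ∀ {t} → 1 ≤ t → + (2 * t ∸ 1) ≡ + 2 ℤ.* + t ℤ.- 1ℤ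
pos-2t∸1 {t} 1≤t = trans (pos-∸ (ℕ.≤-trans 1≤t (ℕ.m≤n*m t 2)))
  (cong (ℤ._- 1ℤ) (ℤ.pos-* 2 t))

-- The case m = 4 is `K₀`, and m = 2 is `Λ₀`.
pos-[2t∸1]* : ∀ {t} m → 1 ≤ t →
  + ((2 * t ∸ 1) * (m * t ℕ.+ 3)) ≡ (+ 2 ℤ.* + t ℤ.- 1ℤ) ℤ.* (+ m ℤ.* + t ℤ.+ + 3)
pos-[2t∸1]* {t} m 1≤t = trans (ℤ.pos-* (2 * t ∸ 1) _)
  (cong₂ ℤ._*_ (pos-2t∸1 1≤t) (cong (ℤ._+ + 3) (ℤ.pos-* m t)))

-- Makes the subtraction in `K₁` exact. For t = 1 + s the difference is 4s² + 3s + 1.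
5t≤4t²+2 : ∀ {t} → 1 ≤ t → 5 * t ≤ 4 * (t * t) ℕ.+ 2
5t≤4t²+2 {ℕ.suc s} _ =
  subst (5 * ℕ.suc s ≤_) (gap s) (ℕ.m≤m+n (5 * ℕ.suc s) (4 * (s * s) ℕ.+ 3 * s ℕ.+ 1))
  where
  gap : ∀ s → 5 * (1 ℕ.+ s) ℕ.+ (4 * (s * s) ℕ.+ 3 * s ℕ.+ 1)
    ≡ 4 * ((1 ℕ.+ s) * (1 ℕ.+ s)) ℕ.+ 2
  gap = ℕ-Solver.solve-∀

pos-K₁ : ∀ {t} → 1 ≤ t →
  + K₁ t ≡ + 2 ℤ.* (+ 4 ℤ.* (+ t ℤ.* + t) ℤ.+ + 2 ℤ.- + 5 ℤ.* + t)
pos-K₁ {t} 1≤t = trans (ℤ.pos-* 2 ((4 * (t * t) ℕ.+ 2) ∸ 5 * t))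
  (cong (+ 2 ℤ.*_) (trans (pos-∸ (5t≤4t²+2 1≤t))
    (cong₂ (λ p q → p ℤ.+ + 2 ℤ.- q)
      (trans (ℤ.pos-* 4 (t * t)) (cong (+ 4 ℤ.*_) (ℤ.pos-* t t)))
      (ℤ.pos-* 5 t))))

pos-Λ₁ : ∀ {t} → 1 ≤ t → + Λ₁ t ≡ + 4 ℤ.* ((+ t ℤ.- 1ℤ) ℤ.* (+ t ℤ.- 1ℤ))
pos-Λ₁ {t} 1≤t = trans (ℤ.pos-* 4 ((t ∸ 1) * (t ∸ 1)))
  (cong (+ 4 ℤ.*_) (trans (ℤ.pos-* (t ∸ 1) (t ∸ 1))
    (cong₂ ℤ._*_ (pos-∸ 1≤t) (pos-∸ 1≤t))))

-- Sign matrices of the tournament and the two cubes.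

module Tournament {t} (1≤t : 1 ≤ t) {A₀ : Matrix (4 * t ∸ 1)}
                  (drt : IsDoublyRegularTournament t A₀) where
  open IsDoublyRegularTournament drt
  open IsSymmetricDesign design

  order : ℕ
  order = 4 * t ∸ 1

  A₁ : Matrix order
  A₁ = A₀ ⊕ 𝐈

  M : Fin order → Fin order → ℤ
  M x y = sign (A₀ x y)

  pos-tournament : ∀ x y → + A₀ x y ℤ.+ + A₀ y x ≡ 1ℤ ℤ.- δ x y
  pos-tournament x y = trans (cong +_ (tournament x y)) (pos-∸ (𝐈≤1 x y))
    where
    𝐈≤1 : ∀ x y → 𝐈 x y ≤ 1
    𝐈≤1 x y with does (x Fin.≟ y)
    ... | true  = ℕ.≤-refl
    ... | false = ℕ.z≤n

  -- The value is (4t - 1) - 2(2t - 1) = 1. Stating it for any vector serves rows and columns alike.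
  line-sum : {a : Vector ℕ order} → (∀ i → Binary (a i)) → ones a ≡ 2 * t ∸ 1 →
    ∑[ i < order ] sign (a i) ≡ 1ℤ
  line-sum bin k = trans (∑-sign bin)
    (trans (cong₂ (λ p q → p ℤ.- + 2 ℤ.* q) (pos-order 1≤t)
             (trans (cong +_ k) (pos-2t∸1 1≤t)))
      (value (+ t)))
    where
    value : ∀ T → + 4 ℤ.* T ℤ.- 1ℤ ℤ.- + 2 ℤ.* (+ 2 ℤ.* T ℤ.- 1ℤ) ≡ 1ℤ
    value = ℤ-Solver.solve-∀

  -- The value is (4t - 1) - 4(2t - 1) + 4(t - 1) = -1.
  line-prod : {a b : Vector ℕ order} → (∀ i → Binary (a i)) → (∀ i → Binary (b i)) →
    ones a ≡ 2 * t ∸ 1 → ones b ≡ 2 * t ∸ 1 → a · b ≡ t ∸ 1 →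
    ∑[ i < order ] (sign (a i) ℤ.* sign (b i)) ≡ -1ℤ
  line-prod {a} {b} bin-a bin-b k k′ l = begin
    ∑[ i < order ] (sign (a i) ℤ.* sign (b i))
      ≡⟨ ∑-sign-* bin-a bin-b ⟩
    _ ≡⟨ cong₂ (λ p q → + order ℤ.- + 2 ℤ.* + p ℤ.- + 2 ℤ.* + q ℤ.+ + 4 ℤ.* + (a · b)) k k′ ⟩
    _ ≡⟨ cong₂ (λ p q → + order ℤ.- + 2 ℤ.* p ℤ.- + 2 ℤ.* p ℤ.+ + 4 ℤ.* q)
           (pos-2t∸1 1≤t) (trans (cong +_ l) (pos-∸ 1≤t)) ⟩
    _ ≡⟨ cong (λ p → p ℤ.- + 2 ℤ.* k̂ ℤ.- + 2 ℤ.* k̂ ℤ.+ + 4 ℤ.* (+ t ℤ.- 1ℤ))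
           (pos-order 1≤t) ⟩
    _ ≡⟨ value (+ t) ⟩
    -1ℤ ∎
    where
    k̂ : ℤ
    k̂ = + 2 ℤ.* + t ℤ.- 1ℤ
    value : ∀ T → + 4 ℤ.* T ℤ.- 1ℤ ℤ.- + 2 ℤ.* (+ 2 ℤ.* T ℤ.- 1ℤ)
      ℤ.- + 2 ℤ.* (+ 2 ℤ.* T ℤ.- 1ℤ) ℤ.+ + 4 ℤ.* (T ℤ.- 1ℤ) ≡ -1ℤ
    value = ℤ-Solver.solve-∀

  core : IsSkewCore order 1ℤ M
  core = record
    { ε²       = refl
    ; entry²   = λ x y → sign² (binary x y)
    ; row-sum  = λ x → line-sum (binary x) (row-ones x)
    ; col-sum  = λ y → line-sum (λ x → binary x y) (column-ones y)
    ; row-prod = λ x x′ x≢x′ →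
        line-prod (binary x) (binary x′) (row-ones x) (row-ones x′) (row-prod x x′ x≢x′)
    ; col-prod = λ y y′ y≢y′ →
        line-prod (λ x → binary x y) (λ x → binary x y′)
          (column-ones y) (column-ones y′) (column-prod y y′ y≢y′)
    -- In signs, A₀ + A₀ᵀ = J - I becomes M + Mᵀ = 2J - 2(J - I) = 2I.
    ; skew     = λ x y → trans (gather (+ A₀ x y) (+ A₀ y x))
        (trans (cong (λ p → + 2 ℤ.- + 2 ℤ.* p) (pos-tournament x y)) (simplify (δ x y)))
    }
    where
    gather : ∀ a b → 1ℤ ℤ.- + 2 ℤ.* a ℤ.+ (1ℤ ℤ.- + 2 ℤ.* b) ≡ + 2 ℤ.- + 2 ℤ.* (a ℤ.+ b)
    gather = ℤ-Solver.solve-∀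
    simplify : ∀ d → + 2 ℤ.- + 2 ℤ.* (1ℤ ℤ.- d) ≡ + 2 ℤ.* 1ℤ ℤ.* d
    simplify = ℤ-Solver.solve-∀

  -- By the tournament condition, adding the identity to A₀ gives the complement of A₀ᵀ; this yields
  -- both that `A₁` is binary and its signs.
  pos-A₁ : ∀ x y → + A₁ x y ≡ 1ℤ ℤ.- + A₀ y x
  pos-A₁ x y = begin
    + A₀ x y ℤ.+ δ x y                          ≡⟨ expand (+ A₀ x y) (+ A₀ y x) (δ x y) ⟩
    + A₀ x y ℤ.+ + A₀ y x ℤ.+ δ x y ℤ.- + A₀ y x
      ≡⟨ cong (λ p → p ℤ.+ δ x y ℤ.- + A₀ y x) (pos-tournament x y) ⟩
    1ℤ ℤ.- δ x y ℤ.+ δ x y ℤ.- + A₀ y x         ≡⟨ collapse (+ A₀ y x) (δ x y) ⟩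
    1ℤ ℤ.- + A₀ y x                             ∎
    where
    expand : ∀ a b d → a ℤ.+ d ≡ a ℤ.+ b ℤ.+ d ℤ.- b
    expand = ℤ-Solver.solve-∀
    collapse : ∀ b d → 1ℤ ℤ.- d ℤ.+ d ℤ.- b ≡ 1ℤ ℤ.- b
    collapse = ℤ-Solver.solve-∀

  A₁-binary : ∀ x y → Binary (A₁ x y)
  A₁-binary x y = complement (binary y x) (pos-A₁ x y)
    where
    complement : ∀ {a b} → Binary b → + a ≡ 1ℤ ℤ.- + b → Binary a
    complement (inj₁ refl) a≡1 = inj₂ (ℤ.+-injective a≡1)
    complement (inj₂ refl) a≡0 = inj₁ (ℤ.+-injective a≡0)

  sign-A₁ : ∀ x y → sign (A₁ x y) ≡ - M y x
  sign-A₁ x y = trans (cong (λ p → 1ℤ ℤ.- + 2 ℤ.* p) (pos-A₁ x y)) (flip (+ A₀ y x))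
    where
    flip : ∀ b → 1ℤ ℤ.- + 2 ℤ.* (1ℤ ℤ.- b) ≡ - (1ℤ ℤ.- + 2 ℤ.* b)
    flip = ℤ-Solver.solve-∀

  -- With v = 4t - 1 and ε = 1, K = (v² - ε(4 - 3v))/2 is 8t² + 2t - 3 and Λ = (1 - v² + 4K)/4 is
  -- 4t² + 4t - 3; both have the factor 2t - 1.
  cube₀ : IsCube order (K₀ t) (Λ₀ t) (cyclicArray A₀)
  cube₀ = cyclicArray-isCube core binary (λ _ _ → refl)
    (pos-order 1≤t) (pos-[2t∸1]* 4 1≤t) (pos-[2t∸1]* 2 1≤t) (K-value (+ t)) (Λ-value (+ t))
    where
    K-value : ∀ T → 1ℤ ℤ.* (+ 4 ℤ.- + 3 ℤ.* (+ 4 ℤ.* T ℤ.- 1ℤ))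
      ≡ (+ 4 ℤ.* T ℤ.- 1ℤ) ℤ.* (+ 4 ℤ.* T ℤ.- 1ℤ)
        ℤ.- + 2 ℤ.* ((+ 2 ℤ.* T ℤ.- 1ℤ) ℤ.* (+ 4 ℤ.* T ℤ.+ + 3))
    K-value = ℤ-Solver.solve-∀
    Λ-value : ∀ T → 1ℤ ≡ (+ 4 ℤ.* T ℤ.- 1ℤ) ℤ.* (+ 4 ℤ.* T ℤ.- 1ℤ)
      ℤ.- + 2 ℤ.* ((+ 2 ℤ.* T ℤ.- 1ℤ) ℤ.* (+ 4 ℤ.* T ℤ.+ + 3))
      ℤ.- + 2 ℤ.* ((+ 2 ℤ.* T ℤ.- 1ℤ) ℤ.* (+ 4 ℤ.* T ℤ.+ + 3))
      ℤ.+ + 4 ℤ.* ((+ 2 ℤ.* T ℤ.- 1ℤ) ℤ.* (+ 2 ℤ.* T ℤ.+ + 3))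
    Λ-value = ℤ-Solver.solve-∀

  -- The same formulas with ε = -1 give K = 8t² - 10t + 4 and Λ = 4t² - 8t + 4.
  cube₁ : IsCube order (K₁ t) (Λ₁ t) (cyclicArray A₁)
  cube₁ = cyclicArray-isCube (neg-transpose core) A₁-binary sign-A₁
    (pos-order 1≤t) (pos-K₁ 1≤t) (pos-Λ₁ 1≤t) (K-value (+ t)) (Λ-value (+ t))
    where
    K-value : ∀ T → -1ℤ ℤ.* (+ 4 ℤ.- + 3 ℤ.* (+ 4 ℤ.* T ℤ.- 1ℤ))
      ≡ (+ 4 ℤ.* T ℤ.- 1ℤ) ℤ.* (+ 4 ℤ.* T ℤ.- 1ℤ)
        ℤ.- + 2 ℤ.* (+ 2 ℤ.* (+ 4 ℤ.* (T ℤ.* T) ℤ.+ + 2 ℤ.- + 5 ℤ.* T))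
    K-value = ℤ-Solver.solve-∀
    Λ-value : ∀ T → 1ℤ ≡ (+ 4 ℤ.* T ℤ.- 1ℤ) ℤ.* (+ 4 ℤ.* T ℤ.- 1ℤ)
      ℤ.- + 2 ℤ.* (+ 2 ℤ.* (+ 4 ℤ.* (T ℤ.* T) ℤ.+ + 2 ℤ.- + 5 ℤ.* T))
      ℤ.- + 2 ℤ.* (+ 2 ℤ.* (+ 4 ℤ.* (T ℤ.* T) ℤ.+ + 2 ℤ.- + 5 ℤ.* T))
      ℤ.+ + 4 ℤ.* (+ 4 ℤ.* ((T ℤ.- 1ℤ) ℤ.* (T ℤ.- 1ℤ)))
    Λ-value = ℤ-Solver.solve-∀

theorem4p8 : (t : ℕ) → 1 ≤ t → (A₀ : Matrix (4 * t ∸ 1)) →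
    IsDoublyRegularTournament t A₀ →
    IsCube (4 * t ∸ 1) (K₀ t) (Λ₀ t) (cyclicArray A₀)
    × IsCube (4 * t ∸ 1) (K₁ t) (Λ₁ t) (cyclicArray (A₀ ⊕ 𝐈))
theorem4p8 t 1≤t A₀ drt = cube₀ , cube₁
  where open Tournament 1≤t drt
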